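{- Let $(g_n(k))$ and $(h_n(k))$ ($n\ge1$, $1\le k\le 2n-1$) be the unique solutions of $$f_n(k+2)-2f_n(k+1)+f_n(k)+4\,f_{n-1}(k)=0\qquad (n\ge 2,\ 1\le k\le 2n-3)$$ with, respectively, the initial values $f_1(1)=1$, $f_n(1)=0$, $f_n(2)=2\sum_kf_{n-1}(k)$ ($n\ge2$), and $f_1(1)=1$, $f_n(1)=\sum_kf_{n-1}(k)$, $f_n(2)=3\sum_kf_{n-1}(k)$ ($n\ge2$). Then $$g_n(k)=\#\mathfrak A_{2n-1,k-1}\quad(n\ge1,\ 1\le k\le 2n-1),\qquad h_n(k)=\#\mathfrak A_{2n,k}\quad(n\ge1,\ 1\le k\le 2n-1).$$
   Context: A permutation $\sigma=\sigma(1)\sigma(2)\cdots\sigma(n)$ of $\{1,\dots,n\}$ is alternating if $\sigma(1)>\sigma(2)<\sigma(3)>\sigma(4)<\cdots$ (alternately). $\mathfrak A_n$ denotes the set of alternating permutations of $\{1,\dots,n\}$. For $\sigma\in\mathfrak A_n$ with $\sigma(i)=n$, set $\sigma(0)=\sigma(n+1):=0$ and define $\mathrm{grn}(\sigma):=\max\{\sigma(i-1),\sigma(i+1)\}$ (the greater neighbor of $n$). For $0\le k\le n-1$, $\mathfrak A_{n,k}:=\{\sigma\in\mathfrak A_n:\mathrm{grn}(\sigma)=k\}$. -}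

module Defs where

open import Data.Nat using (ℕ; zero; suc; _<_; _≤_; _⊔_; _∸_)
import Data.Nat as ℕ
open import Data.Integer using (ℤ; +_; _+_; _-_; _*_)
open import Data.List using (List; []; _∷_; _++_; map; upTo; length)
open import Data.List.Relation.Binary.Permutation.Propositional using (_↭_)
open import Data.List.Membership.Propositional using (_∈_)
open import Data.List.Relation.Unary.Unique.Propositional using (Unique)
open import Data.Product using (Σ; _×_; ∃; ∃-syntax)
open import Data.Unit using (⊤)
open import Relation.Binary.PropositionalEquality using (_≡_)

IsPerm : ℕ → List ℕ → Set
IsPerm n σ = σ ↭ map suc (upTo n)

mutual
  Down : List ℕ → Set
  Down (a ∷ b ∷ rest) = b < a × Up (b ∷ rest)
  Down _ = ⊤

  Up : List ℕ → Set
  Up (a ∷ b ∷ rest) = a < b × Down (b ∷ rest)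
  Up _ = ⊤

Alternating : List ℕ → Set
Alternating = Down

-- last element, with the convention σ(0) = 0 / σ(n+1) = 0 for missing neighbours
last0 : List ℕ → ℕ
last0 [] = 0
last0 (x ∷ []) = x
last0 (x ∷ y ∷ xs) = last0 (y ∷ xs)

head0 : List ℕ → ℕ
head0 [] = 0
head0 (x ∷ _) = x

-- grn(σ) = k, where n is the largest letter: σ = l ++ n ∷ r and k = max(last l, head r)
Grn : ℕ → List ℕ → ℕ → Set
Grn n σ k = ∃[ l ] ∃[ r ] (σ ≡ l ++ n ∷ r × k ≡ last0 l ⊔ head0 r)

InA : ℕ → ℕ → List ℕ → Set
InA n k σ = IsPerm n σ × Alternating σ × Grn n σ k

HasCard : (List ℕ → Set) → ℕ → Set
HasCard P c = ∃[ L ] (Unique L × (∀ σ → (σ ∈ L → P σ) × (P σ → σ ∈ L)) × length L ≡ c)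

ΣZ : ℕ → (ℕ → ℤ) → ℤ
ΣZ zero f = + 0
ΣZ (suc m) f = ΣZ m f + f (suc m)

Recurrence : (ℕ → ℕ → ℤ) → Set
Recurrence f = ∀ n k → 2 ≤ n → 1 ≤ k → k ≤ 2 ℕ.* n ∸ 3 →
  f n (suc (suc k)) - + 2 * f n (suc k) + f n k + + 4 * f (n ∸ 1) k ≡ + 0

prevSum : (ℕ → ℕ → ℤ) → ℕ → ℤ
prevSum f n = ΣZ (2 ℕ.* (n ∸ 1) ∸ 1) (f (n ∸ 1))

IsSolG : (ℕ → ℕ → ℤ) → Set
IsSolG f = Recurrence f × f 1 1 ≡ + 1 ×
  (∀ n → 2 ≤ n → f n 1 ≡ + 0 × f n 2 ≡ + 2 * prevSum f n)

IsSolH : (ℕ → ℕ → ℤ) → Set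
IsSolH f = Recurrence f × f 1 1 ≡ + 1 ×
  (∀ n → 2 ≤ n → f n 1 ≡ prevSum f n × f n 2 ≡ + 3 * prevSum f n)

{-# OPTIONS --safe #-}
module Submission where

-- Cutting σ at its maximum N = m + 1 gives a pair of words (the left one read backwards), both starting with a
-- valley, whose letters together are 1, …, m; the greater neighbour of N is the larger first letter.  More
-- generally, count pairs of alternating words sharing the letters 1, …, n in which each first letter lies on a
-- prescribed side (H: ≥ k, L: < k) of a common threshold k.  Moving one threshold past k changes the count by the
-- pairs where k is a first letter; deleting k and standardising turns these into pairs on n − 1 letters with both
-- thresholds at k and that side flipped.  Hence
--   HL(n, k+1) − HL(n, k) = HH(n−1, k) − LL(n−1, k),
--   HH(n, k) − HH(n, k+1) = LL(n, k+1) − LL(n, k) = S(n−1, k),   where S = HL + LH,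
-- so that Δ²S(n, k) = −4 S(n−2, k).  The number of σ with greater neighbour k ≥ 1 is
-- LL(m, k+1) − LL(m, k) = S(m−1, k).

open import Defs
open import Data.Nat using (ℕ; zero; suc; pred; _+_; _*_; _∸_; _≤_; _<_; _⊔_; z≤n; s≤s; s≤s⁻¹)
open import Data.Nat.Properties
open import Data.Nat.Tactic.RingSolver using (solve-∀)
open import Data.Integer using (ℤ; +_)
import Data.Integer as ℤ
import Data.Integer.Properties as ℤP
import Data.Integer.Tactic.RingSolver as ℤSolver
open import Data.List using (List; []; _∷_; _++_; _ʳ++_; map; upTo; length; reverse; filter; deduplicate; cartesianProduct; cartesianProductWith)
open import Data.List.Properties
  using (map-∘; map-++; map-upTo; map-id-local; length-map; length-++; length-upTo; upTo-∷ʳ; ∷-injective;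
         ʳ++-defn; reverse-involutive; unfold-reverse)
  renaming (≡-dec to List-≡-dec; ++-identityʳ to List-++-identityʳ)
open import Data.List.Membership.Propositional using (_∈_; _∉_)
open import Data.List.Membership.Propositional.Properties
open import Data.List.Membership.DecPropositional _≟_ using (_∈?_)
open import Data.List.Relation.Unary.Any using (here; there)
open import Data.List.Relation.Unary.All as All using (All; []; _∷_)
import Data.List.Relation.Unary.All.Properties as AllP
open import Data.List.Relation.Unary.AllPairs using ([]; _∷_)
open import Data.List.Relation.Unary.Unique.Propositional using (Unique)
import Data.List.Relation.Unary.Unique.Propositional.Properties as UniqueP
import Data.List.Relation.Unary.Unique.DecPropositional.Properties as UniqueDecP
open import Data.List.Relation.Binary.Permutation.Propositional using (_↭_; ↭-refl; ↭-sym; ↭-trans; ↭-reflexive; prep; swap)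
open import Data.List.Relation.Binary.Permutation.Propositional.Properties
  using (∈-resp-↭; All-resp-↭; ↭-length; shift; drop-∷; ++-comm; ++↭ʳ++; ↭-reverse) renaming (map⁺ to ↭-map⁺)
open import Data.Product using (_×_; _,_; proj₁; proj₂; ∃-syntax)
open import Data.Product.Properties using () renaming (≡-dec to ×-≡-dec)
open import Data.Sum using (_⊎_; inj₁; inj₂; [_,_]′)
open import Function using (_∘_)
open import Relation.Binary using (DecidableEquality)
open import Relation.Binary.PropositionalEquality
open import Relation.Nullary using (¬_; Dec; yes; no; contradiction; _×-dec_)
open import Relation.Nullary.Decidable using (map′)
open import Relation.Unary using (Decidable)

-- Cardinalities of predicates.

private variable
  A B : Set
  P Q : A → Set
  c d : ℕ

Card : (A → Set) → ℕ → Set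
Card P c = ∃[ L ] (Unique L × (∀ x → (x ∈ L → P x) × (P x → x ∈ L)) × length L ≡ c)

Unique-⊆⇒length≤ : {xs ys : List A} → Unique xs → (∀ {x} → x ∈ xs → x ∈ ys) → length xs ≤ length ys
Unique-⊆⇒length≤ {xs = []} _ _ = z≤n
Unique-⊆⇒length≤ {xs = x ∷ xs} {ys} (x∉xs ∷ uxs) sub with ∈-∃++ (sub (here refl))
... | ps , qs , refl = subst (suc (length xs) ≤_) (sym (↭-length (shift x ps qs)))
                         (s≤s (Unique-⊆⇒length≤ uxs sub′))
  where
  sub′ : ∀ {y} → y ∈ xs → y ∈ ps ++ qs
  sub′ y∈xs with ∈-resp-↭ (shift x ps qs) (sub (there y∈xs))
  ... | here refl = contradiction refl (All.lookup x∉xs y∈xs)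
  ... | there y∈ = y∈

-- Source of the basic equalities between counts: one predicate is counted in two ways.
Card-unique : Card P c → Card P d → c ≡ d
Card-unique (_ , u , m , refl) (_ , u′ , m′ , refl) =
  ≤-antisym (Unique-⊆⇒length≤ u  λ {x} x∈ → proj₂ (m′ x) (proj₁ (m x) x∈))
            (Unique-⊆⇒length≤ u′ λ {x} x∈ → proj₂ (m x) (proj₁ (m′ x) x∈))

Card-cong : (∀ x → P x → Q x) → (∀ x → Q x → P x) → Card P c → Card Q c
Card-cong p⇒q q⇒p (L , u , m , l) = L , u , (λ x → p⇒q x ∘ proj₁ (m x) , proj₂ (m x) ∘ q⇒p x) , l

Card-∅ : (∀ x → ¬ P x) → Card P 0
Card-∅ ¬p = [] , [] , (λ x → (λ ()) , λ px → contradiction px (¬p x)) , refl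

Card-singleton : (a : A) → Card (_≡ a) 1
Card-singleton a = a ∷ [] , [] ∷ [] , (λ x → (λ { (here eq) → eq }) , here) , refl

Card-⊎ : (∀ x → P x → ¬ Q x) → Card P c → Card Q d → Card (λ x → P x ⊎ Q x) (c + d)
Card-⊎ disj (L , u , m , refl) (L′ , u′ , m′ , refl) =
  L ++ L′
  , UniqueP.++⁺ u u′ (λ {x} (x∈L , x∈L′) → disj x (proj₁ (m x) x∈L) (proj₁ (m′ x) x∈L′))
  , (λ x → [ inj₁ ∘ proj₁ (m x) , inj₂ ∘ proj₁ (m′ x) ]′ ∘ ∈-++⁻ L
         , [ ∈-++⁺ˡ ∘ proj₂ (m x) , ∈-++⁺ʳ L ∘ proj₂ (m′ x) ]′)
  , length-++ L

Image : (A → B) → (A → Set) → B → Set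
Image f P y = ∃[ x ] (P x × y ≡ f x)

Card-Image : (f : A → B) → (∀ {x y} → P x → P y → f x ≡ f y → x ≡ y) → Card P c → Card (Image f P) c
Card-Image {P = P} f inj (L , u , m , refl) =
  map f L
  , unique u (λ x∈ → proj₁ (m _) x∈)
  , (λ y → (λ y∈ → let x , x∈ , eq = ∈-map⁻ f y∈ in x , proj₁ (m x) x∈ , eq)
         , (λ { (x , px , refl) → ∈-map⁺ f (proj₂ (m x) px) }))
  , length-map f L
  where
  unique : ∀ {xs} → Unique xs → (∀ {x} → x ∈ xs → P x) → Unique (map f xs)
  unique [] _ = []
  unique (x∉ ∷ uxs) all =
    AllP.map⁺ (All.tabulate λ y∈ eq → All.lookup x∉ y∈ (inj (all (here refl)) (all (there y∈)) eq))
    ∷ unique uxs (all ∘ there)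

Card-finite : DecidableEquality A → Decidable P → (L : List A) → (∀ x → P x → x ∈ L) → ∃[ c ] Card P c
Card-finite _≟ᴬ_ P? L ⊆L =
  _ , deduplicate _≟ᴬ_ (filter P? L)
    , UniqueDecP.deduplicate-! _≟ᴬ_ (filter P? L)
    , (λ x → (λ x∈ → proj₂ (∈-filter⁻ P? {xs = L} (∈-deduplicate⁻ _≟ᴬ_ (filter P? L) x∈)))
           , (λ px → ∈-deduplicate⁺ _≟ᴬ_ (∈-filter⁺ P? (⊆L x px) px)))
    , refl

-- Deciding permutations and enumerating words.

_↭?_ : (xs ys : List ℕ) → Dec (xs ↭ ys)
[] ↭? [] = yes ↭-refl
[] ↭? (y ∷ ys) = no λ p → contradiction (↭-length p) λ ()
(x ∷ xs) ↭? ys with x ∈? ys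
... | no x∉ = no λ p → x∉ (∈-resp-↭ p (here refl))
... | yes x∈ with ∈-∃++ x∈
... | ps , qs , refl = map′ (λ p → ↭-trans (prep x p) (↭-sym (shift x ps qs)))
                            (λ p → drop-∷ (↭-trans p (shift x ps qs)))
                            (xs ↭? (ps ++ qs))

words : ℕ → ℕ → List (List ℕ)
words m zero = [] ∷ []
words m (suc l) = [] ∷ cartesianProductWith _∷_ (upTo m) (words m l)

∈-words : ∀ {m} l {w} → All (_< m) w → length w ≤ l → w ∈ words m l
∈-words zero    []       _ = here refl
∈-words (suc l) []       _ = here refl
∈-words (suc l) (x< ∷ w<) (s≤s le) = there (∈-cartesianProductWith⁺ _∷_ (∈-upTo⁺ x<) (∈-words l w< le))

letters : ℕ → List ℕ
letters n = map suc (upTo n)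

letters-suc : ∀ n → letters (suc n) ≡ 1 ∷ map suc (letters n)
letters-suc n = cong (λ xs → 1 ∷ map suc xs) (sym (map-upTo suc n))

letters-bounds : ∀ n → All (λ x → 1 ≤ x × x ≤ n) (letters n)
letters-bounds n = AllP.map⁺ (All.tabulate λ x∈ → s≤s z≤n , ∈-upTo⁻ x∈)

length-letters : ∀ n → length (letters n) ≡ n
length-letters n = trans (length-map suc (upTo n)) (length-upTo n)

perm-bounds : ∀ {n w} → IsPerm n w → All (λ x → 1 ≤ x × x ≤ n) w
perm-bounds {n} p = All-resp-↭ (↭-sym p) (letters-bounds n)

-- Alternating words relative to a threshold, and pairs of them.

data Side : Set where
  hi lo : Side

opp : Side → Side
opp hi = lo
opp lo = hi

OnSide : Side → ℕ → ℕ → Set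
OnSide hi j x = j ≤ x
OnSide lo j x = x < j

-- A threshold `j` stands for the gap just below the letter `j`. Of the two gaps next to `k`,
-- `strict s k` leaves `k` off side `s` and `loose s k` puts it on.
strict loose : Side → ℕ → ℕ
strict hi k = suc k
strict lo k = k
loose hi k = k
loose lo k = suc k

-- e tells whether the last letter is a peak (hi) or a valley (lo); for the empty word, the last letter is the one
-- preceding it.
Chain : Side → Side → ℕ → List ℕ → Set
Chain s e j []      = e ≡ opp s
Chain s e j (x ∷ w) = OnSide s j x × Chain (opp s) e (strict (opp s) x) w

_≟ˢ_ : DecidableEquality Side
hi ≟ˢ hi = yes refl
hi ≟ˢ lo = no λ ()
lo ≟ˢ hi = no λ ()
lo ≟ˢ lo = yes refl

onSide? : ∀ s j x → Dec (OnSide s j x)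
onSide? hi j x = j ≤? x
onSide? lo j x = x <? j

chain? : ∀ s e j → Decidable (Chain s e j)
chain? s e j []      = e ≟ˢ opp s
chain? s e j (x ∷ w) = onSide? s j x ×-dec chain? (opp s) e (strict (opp s) x) w

-- The thresholds `i` and `j` are separate parameters because peeling moves them past a letter one
-- at a time.
Zip : ℕ → (s e : Side) → ℕ → (t f : Side) → ℕ → List ℕ × List ℕ → Set
Zip n s e i t f j (a , b) = IsPerm n (a ++ b) × Chain s e i a × Chain t f j b

zip? : ∀ n s e i t f j → Decidable (Zip n s e i t f j)
zip? n s e i t f j (a , b) = ((a ++ b) ↭? letters n) ×-dec (chain? s e i a ×-dec chain? t f j b)

splits : ℕ → List (List ℕ × List ℕ)
splits n = cartesianProduct (words (suc n) n) (words (suc n) n)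

∈-splits : ∀ {n a b} → IsPerm n (a ++ b) → (a , b) ∈ splits n
∈-splits {n} {a} {b} p = ∈-cartesianProduct⁺
  (∈-words n (AllP.++⁻ˡ a bounds) (≤-trans (m≤m+n _ _) len≤))
  (∈-words n (AllP.++⁻ʳ a bounds) (≤-trans (m≤n+m _ _) len≤))
  where
  bounds : All (_< suc n) (a ++ b)
  bounds = All.map (s≤s ∘ proj₂) (perm-bounds p)
  len≤ : length a + length b ≤ n
  len≤ = ≤-reflexive (trans (sym (length-++ a)) (trans (↭-length p) (length-letters n)))

_≟ᵖ_ : DecidableEquality (List ℕ × List ℕ)
_≟ᵖ_ = ×-≡-dec (List-≡-dec _≟_) (List-≡-dec _≟_)

-- Only the existence of these cardinalities is used; evaluating the enumerations is infeasible.
abstract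
  countable : ∀ n s e i t f j → ∃[ c ] Card (Zip n s e i t f j) c
  countable n s e i t f j = Card-finite _≟ᵖ_ (zip? n s e i t f j) (splits n) λ _ → ∈-splits ∘ proj₁

# : ℕ → (s e : Side) → ℕ → (t f : Side) → ℕ → ℕ
# n s e i t f j = proj₁ (countable n s e i t f j)

#-card : ∀ n s e i t f j → Card (Zip n s e i t f j) (# n s e i t f j)
#-card n s e i t f j = proj₂ (countable n s e i t f j)

#-swap : ∀ n s e i t f j → # n s e i t f j ≡ # n t f j s e i
#-swap n s e i t f j = Card-unique
  (Card-cong to from (Card-Image flip flip-injective (#-card n s e i t f j)))
  (#-card n t f j s e i)
  where
  flip : List ℕ × List ℕ → List ℕ × List ℕ
  flip (a , b) = b , a
  flip-injective : ∀ {x y} → Zip n s e i t f j x → Zip n s e i t f j y → flip x ≡ flip y → x ≡ y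
  flip-injective _ _ refl = refl
  to : ∀ y → Image flip (Zip n s e i t f j) y → Zip n t f j s e i y
  to _ ((a , b) , (p , ca , cb) , refl) = ↭-trans (++-comm b a) p , cb , ca
  from : ∀ y → Zip n t f j s e i y → Image flip (Zip n s e i t f j) y
  from (b , a) (p , cb , ca) = (a , b) , (↭-trans (++-comm a b) p , ca , cb) , refl

-- Deleting and inserting a letter.

-- π k standardises words from which the letter k was removed.  It also translates thresholds: a threshold j lies
-- just below the letter j, so the thresholds k and k + 1 are both sent to k.
π ρ : ℕ → ℕ → ℕ
π zero    x       = pred x
π (suc k) zero    = zero
π (suc k) (suc x) = suc (π k x)
ρ zero    x       = suc x
ρ (suc k) zero    = zero
ρ (suc k) (suc x) = suc (ρ k x)

π-ρ : ∀ k x → π k (ρ k x) ≡ x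
π-ρ zero    x       = refl
π-ρ (suc k) zero    = refl
π-ρ (suc k) (suc x) = cong suc (π-ρ k x)

ρ-π : ∀ k x → k ≢ x → ρ k (π k x) ≡ x
ρ-π zero    zero    k≢x = contradiction refl k≢x
ρ-π zero    (suc x) k≢x = refl
ρ-π (suc k) zero    k≢x = refl
ρ-π (suc k) (suc x) k≢x = cong suc (ρ-π k x (k≢x ∘ cong suc))

ρ-avoids : ∀ k x → k ≢ ρ k x
ρ-avoids (suc k) (suc x) eq = ρ-avoids k x (suc-injective eq)

π-mono-≤ : ∀ k {x y} → x ≤ y → π k x ≤ π k y
π-mono-≤ zero    x≤y       = pred-mono-≤ x≤y
π-mono-≤ (suc k) z≤n       = z≤n
π-mono-≤ (suc k) (s≤s x≤y) = s≤s (π-mono-≤ k x≤y)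

π-suc : ∀ k {x} → k ≢ x → π k (suc x) ≡ suc (π k x)
π-suc zero    {zero}  k≢x = contradiction refl k≢x
π-suc zero    {suc x} k≢x = refl
π-suc (suc k) {zero}  k≢x = cong suc (π-zero k)
  where
  π-zero : ∀ k → π k zero ≡ zero
  π-zero zero    = refl
  π-zero (suc k) = refl
π-suc (suc k) {suc x} k≢x = cong suc (π-suc k (k≢x ∘ cong suc))

-- `π k` identifies only `k` and `k + 1`, so it stays strictly increasing from any `x` other than
-- `k`.
π-mono-< : ∀ k {x y} → k ≢ x → x < y → π k x < π k y
π-mono-< k k≢x x<y = subst (_≤ _) (π-suc k k≢x) (π-mono-≤ k x<y)

π-self : ∀ k → π k k ≡ k
π-self zero    = refl
π-self (suc k) = cong suc (π-self k)

π-self-suc : ∀ k → π k (suc k) ≡ k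
π-self-suc zero    = refl
π-self-suc (suc k) = cong suc (π-self-suc k)

π-strict : ∀ s k → π k (strict s k) ≡ k
π-strict hi = π-self-suc
π-strict lo = π-self

onSide-π⁺ : ∀ s {k j x} → k ≢ x → OnSide s j x → OnSide s (π k j) (π k x)
onSide-π⁺ hi {k} k≢x = π-mono-≤ k
onSide-π⁺ lo {k} k≢x = π-mono-< k k≢x

onSide-π⁻ : ∀ s {k j x} → k ≢ x → OnSide s (π k j) (π k x) → OnSide s j x
onSide-π⁻ hi {k} k≢x le = ≮⇒≥ λ x<j → <⇒≱ (π-mono-< k k≢x x<j) le
onSide-π⁻ lo {k} k≢x lt = ≰⇒> λ j≤x → <⇒≱ lt (π-mono-≤ k j≤x)

strict-π : ∀ s {k x} → k ≢ x → π k (strict s x) ≡ strict s (π k x)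
strict-π hi {k} k≢x = π-suc k k≢x
strict-π lo     k≢x = refl

-- A chain only compares letters with thresholds, and `π k` preserves these comparisons for letters
-- other than `k`; `strict-π` transports the threshold that each letter sets for the next.
chain-π⁺ : ∀ s {e k j w} → All (k ≢_) w → Chain s e j w → Chain s e (π k j) (map (π k) w)
chain-π⁺ s [] ch = ch
chain-π⁺ s {w = x ∷ w} (k≢x ∷ k∉w) (ox , ch) =
  onSide-π⁺ s k≢x ox , subst (λ i → Chain _ _ i _) (strict-π (opp s) k≢x) (chain-π⁺ (opp s) k∉w ch)

chain-π⁻ : ∀ s {e k j w} → All (k ≢_) w → Chain s e (π k j) (map (π k) w) → Chain s e j w
chain-π⁻ s [] ch = ch
chain-π⁻ s {w = x ∷ w} (k≢x ∷ k∉w) (ox , ch) =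
  onSide-π⁻ s k≢x ox , chain-π⁻ (opp s) k∉w (subst (λ i → Chain _ _ i _) (sym (strict-π (opp s) k≢x)) ch)

map-π-ρ : ∀ k w → map (π k) (map (ρ k) w) ≡ w
map-π-ρ k w = trans (sym (map-∘ w)) (map-id-local (All.tabulate λ {x} _ → π-ρ k x))

map-ρ-π : ∀ k {w} → All (k ≢_) w → map (ρ k) (map (π k) w) ≡ w
map-ρ-π k {w} k∉w = trans (sym (map-∘ w)) (map-id-local (All.map (ρ-π k _) k∉w))

ρ-All-avoids : ∀ k w → All (k ≢_) (map (ρ k) w)
ρ-All-avoids k w = AllP.map⁺ (All.tabulate λ {x} _ → ρ-avoids k x)

-- Induction on `k`: if the inserted letter exceeds 1, then `ρ` fixes the letter 1, and the other
-- letters form the previous case shifted by one.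
letters-insert : ∀ k n → k ≤ n → letters (suc n) ↭ suc k ∷ map (ρ (suc k)) (letters n)
letters-insert zero n _ = ↭-reflexive (trans (letters-suc n)
  (cong (1 ∷_) (trans (sym (map-∘ (upTo n))) (map-∘ (upTo n)))))
letters-insert (suc k) (suc n) (s≤s k≤n) = ↭-trans (↭-reflexive (letters-suc (suc n)))
  (↭-trans (prep 1 (↭-map⁺ suc (letters-insert k n k≤n)))
  (↭-trans (swap 1 (2 + k) ↭-refl)
  (↭-reflexive (cong (_∷_ (2 + k)) (trans (cong (1 ∷_) (trans (sym (map-∘ (letters n))) (map-∘ (letters n))))
    (cong (map (ρ (2 + k))) (sym (letters-suc n))))))))

module _ {k n : ℕ} (k≤n : k ≤ n) where

  private
    K = suc k

  perm-tail : ∀ {w} → IsPerm (suc n) (K ∷ w) → w ↭ map (ρ K) (letters n)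
  perm-tail p = drop-∷ (↭-trans p (letters-insert k n k≤n))

  perm-avoids : ∀ {w} → IsPerm (suc n) (K ∷ w) → All (K ≢_) w
  perm-avoids p = All-resp-↭ (↭-sym (perm-tail p)) (ρ-All-avoids K (letters n))

  perm-π : ∀ {w} → IsPerm (suc n) (K ∷ w) → IsPerm n (map (π K) w)
  perm-π p = ↭-trans (↭-map⁺ (π K) (perm-tail p)) (↭-reflexive (map-π-ρ K (letters n)))

  perm-ρ : ∀ {w} → IsPerm n w → IsPerm (suc n) (K ∷ map (ρ K) w)
  perm-ρ p = ↭-trans (prep K (↭-map⁺ (ρ K) p)) (↭-sym (letters-insert k n k≤n))

-- Moving thresholds past a letter.

loosen : ∀ s {k x} → OnSide s (strict s k) x → OnSide s (loose s k) x
loosen hi = <⇒≤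
loosen lo = m<n⇒m<1+n

loose-self : ∀ s k → OnSide s (loose s k) k
loose-self hi k = ≤-refl
loose-self lo k = ≤-refl

strict-irrefl : ∀ s {k} → ¬ OnSide s (strict s k) k
strict-irrefl hi = <-irrefl refl
strict-irrefl lo = <-irrefl refl

loose-split : ∀ s k x → OnSide s (loose s k) x → OnSide s (strict s k) x ⊎ x ≡ k
loose-split hi k x le with m≤n⇒m<n∨m≡n le
... | inj₁ lt = inj₁ lt
... | inj₂ eq = inj₂ (sym eq)
loose-split lo k x (s≤s le) = m≤n⇒m<n∨m≡n le

module _ {k n : ℕ} (k≤n : k ≤ n) (s e t f : Side) {j : ℕ} (πj≡ : π (suc k) j ≡ suc k) where

  private
    K = suc k

    insert : List ℕ × List ℕ → List ℕ × List ℕ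
    insert (a , b) = K ∷ map (ρ K) a , map (ρ K) b

    insert-injective : ∀ {x y} → insert x ≡ insert y → x ≡ y
    insert-injective {a , b} {a′ , b′} eq = cong₂ _,_
      (trans (sym (map-π-ρ K a)) (trans (cong (map (π K)) (proj₂ (∷-injective (cong proj₁ eq)))) (map-π-ρ K a′)))
      (trans (sym (map-π-ρ K b)) (trans (cong (map (π K)) (cong proj₂ eq)) (map-π-ρ K b′)))

    Headed Strict Loose : List ℕ × List ℕ → Set
    Headed = Image insert (Zip n (opp s) e K t f K)
    Strict = Zip (suc n) s e (strict s K) t f j
    Loose  = Zip (suc n) s e (loose s K) t f j

    split : ∀ x → Loose x → Strict x ⊎ Headed x
    split ([] , b) z = inj₁ z
    split (x ∷ a , b) (p , (ox , ca) , cb) with loose-split s K x ox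
    ... | inj₁ ox′ = inj₁ (p , (ox′ , ca) , cb)
    ... | inj₂ refl = inj₂ ((map (π K) a , map (π K) b)
            , ( subst (IsPerm n) (map-++ (π K) a b) (perm-π k≤n p)
              , subst (λ i → Chain _ _ i _) (π-strict (opp s) K) (chain-π⁺ (opp s) K∉a ca)
              , subst (λ i → Chain _ _ i _) πj≡ (chain-π⁺ t K∉b cb) )
            , sym (cong₂ (λ a b → K ∷ a , b) (map-ρ-π K K∉a) (map-ρ-π K K∉b)))
      where
      K∉a = AllP.++⁻ˡ a (perm-avoids k≤n p)
      K∉b = AllP.++⁻ʳ a (perm-avoids k≤n p)

    merge : ∀ x → Strict x ⊎ Headed x → Loose x
    merge ([] , b) (inj₁ z) = z
    merge (x ∷ a , b) (inj₁ (p , (ox , ca) , cb)) = p , (loosen s ox , ca) , cb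
    merge _ (inj₂ ((a , b) , (p , ca , cb) , refl)) =
        subst (IsPerm (suc n) ∘ (K ∷_)) (map-++ (ρ K) a b) (perm-ρ k≤n p)
      , (loose-self s K , unπ (opp s) (π-strict (opp s) K) a ca)
      , unπ t πj≡ b cb
      where
      unπ : ∀ s {e i} → π K i ≡ K → ∀ w → Chain s e K w → Chain s e i (map (ρ K) w)
      unπ s πi≡ w ch = chain-π⁻ s (ρ-All-avoids K w) (subst₂ (Chain s _) (sym πi≡) (sym (map-π-ρ K w)) ch)

    disjoint : ∀ x → Strict x → ¬ Headed x
    disjoint _ (_ , ca , _) (_ , _ , refl) = strict-irrefl s (proj₁ ca)

  -- The pairs gained by loosening are those whose left word starts with `K`. Once `K` is deleted,
  -- the left threshold is `strict (opp s) K` and the right one is still `j`; standardising sends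
  -- both to `K`. The condition `πj≡` says that `j` is `K` or `K + 1`.
  peel : # (suc n) s e (loose s K) t f j ≡ # (suc n) s e (strict s K) t f j + # n (opp s) e K t f K
  peel = Card-unique (#-card (suc n) s e (loose s K) t f j)
    (Card-cong merge split
      (Card-⊎ disjoint
        (#-card (suc n) s e (strict s K) t f j)
        (Card-Image insert (λ _ _ → insert-injective) (#-card n (opp s) e K t f K))))

module _ {k n : ℕ} (k≤n : k ≤ n) (s e t f : Side) where

  private
    K = suc k

  peelʳ : ∀ {i} → π K i ≡ K →
    # (suc n) s e i t f (loose t K) ≡ # (suc n) s e i t f (strict t K) + # n s e K (opp t) f K
  peelʳ {i} πi≡ =
    trans (#-swap (suc n) s e i t f (loose t K))
    (trans (peel k≤n t f s e πi≡)
    (cong₂ _+_ (#-swap (suc n) t f (strict t K) s e i) (#-swap n (opp t) f K s e K)))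

  -- The left threshold moves first, then the right one. No cross term arises, since `K` heads at
  -- most one of the two words.
  peel-both : # (suc n) s e (loose s K) t f (loose t K)
            ≡ # (suc n) s e (strict s K) t f (strict t K) + (# n (opp s) e K t f K + # n s e K (opp t) f K)
  peel-both =
    trans (peel k≤n s e t f (π-loose t))
    (trans (cong (_+ # n (opp s) e K t f K) (peelʳ (π-strict s K)))
    (rearrange (# (suc n) s e (strict s K) t f (strict t K)) (# n s e K (opp t) f K) (# n (opp s) e K t f K)))
    where
    π-loose : ∀ t → π K (loose t K) ≡ K
    π-loose hi = π-self K
    π-loose lo = π-self-suc K
    rearrange : ∀ x y z → x + y + z ≡ x + (z + y)
    rearrange = solve-∀

  -- Both mixed counts are compared with the count having both thresholds strict. On opposite sides,
  -- `strict` for one word and `loose` for the other are the same gap, so this moves a common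
  -- threshold between `K` and `K + 1`.
  peel-exchange : # (suc n) s e (strict s K) t f (loose t K) + # n (opp s) e K t f K
                ≡ # (suc n) s e (loose s K) t f (strict t K) + # n s e K (opp t) f K
  peel-exchange =
    trans (cong (_+ # n (opp s) e K t f K) (peelʳ (π-strict s K)))
    (trans (rearrange (# (suc n) s e (strict s K) t f (strict t K)) (# n s e K (opp t) f K) (# n (opp s) e K t f K))
    (cong (_+ # n s e K (opp t) f K) (sym (peel k≤n s e t f (π-strict t K)))))
    where
    rearrange : ∀ x y z → x + y + z ≡ x + z + y
    rearrange = solve-∀

-- Difference equations in a common threshold.

module Counts (e f : Side) where

  HH HL LH LL S : ℕ → ℕ → ℕ
  HH n k = # n hi e k hi f k
  HL n k = # n hi e k lo f k
  LH n k = # n lo e k hi f k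
  LL n k = # n lo e k lo f k
  S n k = HL n k + LH n k

  HH-step : ∀ {k n} → k ≤ n → HH (suc n) (suc k) ≡ HH (suc n) (2 + k) + S n (suc k)
  HH-step {k} {n} k≤n = trans (peel-both k≤n hi e hi f)
    (cong (_+_ (HH (suc n) (2 + k))) (+-comm (LH n (suc k)) (HL n (suc k))))

  LL-step : ∀ {k n} → k ≤ n → LL (suc n) (2 + k) ≡ LL (suc n) (suc k) + S n (suc k)
  LL-step k≤n = peel-both k≤n lo e lo f

  -- `HL` and `LH` each change by `HH n (suc k)` minus `LL n (suc k)`, hence the factor 2.
  S-step : ∀ {k n} → k ≤ n → S (suc n) (2 + k) + 2 * LL n (suc k) ≡ S (suc n) (suc k) + 2 * HH n (suc k)
  S-step {k} {n} k≤n = combine (HL (suc n) (2 + k)) (LH (suc n) (2 + k)) (LL n (suc k))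
                               (HL (suc n) (suc k)) (LH (suc n) (suc k)) (HH n (suc k))
    (peel-exchange k≤n hi e lo f) (sym (peel-exchange k≤n lo e hi f))
    where
    combine : ∀ x y u a b d → x + u ≡ a + d → y + u ≡ b + d → x + y + 2 * u ≡ a + b + 2 * d
    combine x y u a b d p q = trans (lem x y u) (trans (cong₂ _+_ p q) (sym (lem a b d)))
      where
      lem : ∀ x y u → x + y + 2 * u ≡ (x + u) + (y + u)
      lem = solve-∀

  -- Difference of two consecutive instances of `S-step`: `HH` falls and `LL` rises by the same
  -- `S n (suc k)`, and each change counts twice.
  S-second-difference : ∀ {k n} → k ≤ n →
    S (2 + n) (3 + k) + S (2 + n) (suc k) + 4 * S n (suc k) ≡ 2 * S (2 + n) (2 + k)
  S-second-difference {k} {n} k≤n =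
    combine (S (2 + n) (suc k)) (S (2 + n) (2 + k)) (S (2 + n) (3 + k))
            (LL (suc n) (suc k)) (LL (suc n) (2 + k)) (HH (suc n) (suc k)) (HH (suc n) (2 + k)) (S n (suc k))
            (S-step (m≤n⇒m≤1+n k≤n)) (S-step (s≤s k≤n)) (HH-step k≤n) (LL-step k≤n)
    where
    combine : ∀ s₀ s₁ s₂ u₀ u₁ d₀ d₁ z → s₁ + 2 * u₀ ≡ s₀ + 2 * d₀ → s₂ + 2 * u₁ ≡ s₁ + 2 * d₁ →
      d₀ ≡ d₁ + z → u₁ ≡ u₀ + z → s₂ + s₀ + 4 * z ≡ 2 * s₁
    combine s₀ s₁ s₂ u₀ _ _ d₁ z eq₀ eq₁ refl refl =
      -- Adding these terms to both sides replaces subtraction in `ℕ`.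
      +-cancelʳ-≡ (2 * u₀ + 2 * d₁) _ _
        (trans (lhs s₀ s₂ u₀ d₁ z) (trans (cong₂ _+_ eq₁ (sym eq₀)) (rhs s₁ u₀ d₁)))
      where
      lhs : ∀ s₀ s₂ u₀ d₁ z → s₂ + s₀ + 4 * z + (2 * u₀ + 2 * d₁) ≡ s₂ + 2 * (u₀ + z) + (s₀ + 2 * (d₁ + z))
      lhs = solve-∀
      rhs : ∀ s₁ u₀ d₁ → s₁ + 2 * d₁ + (s₁ + 2 * u₀) ≡ 2 * s₁ + (2 * u₀ + 2 * d₁)
      rhs = solve-∀

  -- `HH` loses what `LL` gains. This links threshold 1 to the top threshold, where `HH` vanishes.
  HH+LL-constant : ∀ n k → k ≤ n → HH n (suc k) + LL n (suc k) ≡ HH n 1 + LL n 1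
  HH+LL-constant n zero _ = refl
  HH+LL-constant (suc n) (suc k) (s≤s k≤n) =
    trans (cong (_+_ (HH (suc n) (2 + k))) (LL-step k≤n))
    (trans (rearrange (HH (suc n) (2 + k)) (LL (suc n) (suc k)) (S n (suc k)))
    (trans (cong (_+ LL (suc n) (suc k)) (sym (HH-step k≤n)))
    (HH+LL-constant (suc n) k (m≤n⇒m≤1+n k≤n))))
    where
    rearrange : ∀ x y z → x + (y + z) ≡ x + z + y
    rearrange = solve-∀

-- Forced empty words, and cutting a permutation at its maximum.

low-is-empty : ∀ {e w} → All (1 ≤_) w → Chain lo e 1 w → w ≡ []
low-is-empty [] _ = refl
low-is-empty (1≤x ∷ _) (x<1 , _) = contradiction 1≤x (<⇒≱ x<1)

high-is-empty : ∀ {e m w} → All (_≤ m) w → Chain hi e (suc m) w → w ≡ []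
high-is-empty [] _ = refl
high-is-empty (x≤m ∷ _) (m<x , _) = contradiction x≤m (<⇒≱ m<x)

module _ {n : ℕ} (a : List ℕ) {b : List ℕ} (p : IsPerm n (a ++ b)) where

  positiveˡ : All (1 ≤_) a
  positiveˡ = All.map proj₁ (AllP.++⁻ˡ a (perm-bounds p))

  positiveʳ : All (1 ≤_) b
  positiveʳ = All.map proj₁ (AllP.++⁻ʳ a (perm-bounds p))

  boundedˡ : All (_≤ n) a
  boundedˡ = All.map proj₂ (AllP.++⁻ˡ a (perm-bounds p))

IsPerm-length : ∀ {n w} → IsPerm n w → length w ≡ n
IsPerm-length {n} p = trans (↭-length p) (length-letters n)

#-∅ : ∀ {n s e i t f j} → (∀ x → ¬ Zip n s e i t f j x) → # n s e i t f j ≡ 0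
#-∅ {n} {s} {e} {i} {t} {f} {j} ¬z = Card-unique (#-card n s e i t f j) (Card-∅ ¬z)

#-zero : ∀ {s e i t f j} → e ≡ opp s → f ≡ opp t → # 0 s e i t f j ≡ 1
#-zero {s} {e} {i} {t} {f} {j} e≡ f≡ = Card-unique (#-card 0 s e i t f j) (Card-cong to from (Card-singleton ([] , [])))
  where
  to : ∀ x → x ≡ ([] , []) → Zip 0 s e i t f j x
  to _ refl = ↭-refl , e≡ , f≡
  from : ∀ x → Zip 0 s e i t f j x → x ≡ ([] , [])
  from ([] , []) _ = refl
  from ([] , _ ∷ _) (p , _) = contradiction (↭-length p) λ ()
  from (_ ∷ _ , _) (p , _) = contradiction (↭-length p) λ ()

-- The word l is read backwards from x, so its end is the start of the permutation, a peak: hence the end type hi.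
glue : ∀ s {e x} l {r} → All (1 ≤_) l → 1 ≤ x →
  Chain (opp s) hi (strict (opp s) x) l → Chain (opp s) e (strict (opp s) x) r → Chain hi e 1 (l ʳ++ x ∷ r)
glue hi []      _           1≤x _         cr = 1≤x , cr
glue hi (y ∷ l) (1≤y ∷ 1≤l) _   (oy , cl) cr = glue lo l 1≤l 1≤y cl (oy , cr)
glue lo (y ∷ l) (1≤y ∷ 1≤l) _   (oy , cl) cr = glue hi l 1≤l 1≤y cl (oy , cr)

-- Inverse to `glue`. The side `s` of `x` depends on the parity of the length of `l`, so it is found
-- by walking along `l`.
cut : ∀ {e x} l {r} → Chain hi e 1 (l ʳ++ x ∷ r) →
  ∃[ s ] (Chain (opp s) hi (strict (opp s) x) l × Chain (opp s) e (strict (opp s) x) r)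
cut []      (_ , cr) = hi , refl , cr
cut (y ∷ l) ch with cut l ch
... | hi , cl , (ox , cr) = lo , (ox , cl) , cr
... | lo , cl , (ox , cr) = hi , (ox , cl) , cr

-- The maximum is a peak: a valley would either have a larger neighbour in `l` or be the first
-- letter, whose side is `hi`.
cut-max : ∀ {e m} l {r} → All (_≤ m) l → Chain hi e 1 (l ʳ++ suc m ∷ r) →
  Chain lo hi (suc m) l × Chain lo e (suc m) r
cut-max l l≤m ch with cut l ch
... | hi , cl , cr = cl , cr
cut-max [] _ ch | lo , () , cr
cut-max (y ∷ l) (y≤m ∷ _) ch | lo , (oy , _) , cr = contradiction (<-trans (n<1+n _) oy) (≤⇒≯ y≤m)

join : ℕ → List ℕ × List ℕ → List ℕ
join N (l , r) = l ʳ++ N ∷ r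

++-∷-injective : ∀ {N : ℕ} xs xs′ {ys ys′} → N ∉ xs → N ∉ xs′ →
  xs ++ N ∷ ys ≡ xs′ ++ N ∷ ys′ → xs ≡ xs′ × ys ≡ ys′
++-∷-injective []       []         _ _ eq = refl , proj₂ (∷-injective eq)
++-∷-injective []       (x′ ∷ xs′) _ N∉ eq = contradiction (here (proj₁ (∷-injective eq))) N∉
++-∷-injective (x ∷ xs) []         N∉ _ eq = contradiction (here (sym (proj₁ (∷-injective eq)))) N∉
++-∷-injective (x ∷ xs) (x′ ∷ xs′) N∉ N∉′ eq
  with refl , eq′ ← ∷-injective eq
  with refl , eq″ ← ++-∷-injective xs xs′ (N∉ ∘ there) (N∉′ ∘ there) eq′ = refl , eq″

join-injective : ∀ {N l l′ r r′} → N ∉ l → N ∉ l′ → join N (l , r) ≡ join N (l′ , r′) → (l , r) ≡ (l′ , r′)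
join-injective {N} {l} {l′} {r} {r′} N∉l N∉l′ eq = cong₂ _,_
  (trans (sym (reverse-involutive l)) (trans (cong reverse (proj₁ parts)) (reverse-involutive l′)))
  (proj₂ parts)
  where
  ∉-reverse : ∀ {l} → N ∉ l → N ∉ reverse l
  ∉-reverse {l} N∉ = N∉ ∘ ∈-resp-↭ (↭-reverse l)
  parts = ++-∷-injective (reverse l) (reverse l′) (∉-reverse N∉l) (∉-reverse N∉l′)
            (trans (sym (ʳ++-defn l)) (trans eq (ʳ++-defn l′)))

join-↭ : ∀ N l r → join N (l , r) ↭ N ∷ l ++ r
join-↭ N l r = ↭-trans (↭-sym (++↭ʳ++ l (N ∷ r))) (shift N l r)

letters-∷ʳ : ∀ m → letters (suc m) ↭ suc m ∷ letters m
letters-∷ʳ m = ↭-trans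
  (↭-reflexive (trans (cong (map suc) (sym (upTo-∷ʳ m))) (map-++ suc (upTo m) (m ∷ []))))
  (↭-trans (shift (suc m) (letters m) []) (↭-reflexive (cong (suc m ∷_) (List-++-identityʳ (letters m)))))

join-perm⁺ : ∀ {m} l {r} → IsPerm m (l ++ r) → IsPerm (suc m) (join (suc m) (l , r))
join-perm⁺ {m} l {r} p = ↭-trans (join-↭ (suc m) l r) (↭-trans (prep (suc m) p) (↭-sym (letters-∷ʳ m)))

join-perm⁻ : ∀ {m} l {r} → IsPerm (suc m) (join (suc m) (l , r)) → IsPerm m (l ++ r)
join-perm⁻ {m} l {r} p = drop-∷ (↭-trans (↭-sym (join-↭ (suc m) l r)) (↭-trans p (letters-∷ʳ m)))

max-∉ : ∀ {m w} → All (_≤ m) w → suc m ∉ w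
max-∉ w≤m N∈ = <-irrefl refl (All.lookup w≤m N∈)

Alt : Side → ℕ → List ℕ → Set
Alt e m σ = IsPerm m σ × Chain hi e 1 σ

module _ {e : Side} {m : ℕ} where

  private
    N = suc m

  Whole : List ℕ × List ℕ → Set
  Whole = Zip m lo hi N lo e N

  Whole⇒Alt : ∀ {l r} → Whole (l , r) → Alt e N (join N (l , r))
  Whole⇒Alt {l} {r} (p , cl , cr) = join-perm⁺ l p , glue hi l (positiveˡ l p) (s≤s z≤n) cl cr

  Alt⇒Whole : ∀ {l r} → Alt e N (join N (l , r)) → Whole (l , r)
  Alt⇒Whole {l} {r} (p , ch) = join-perm⁻ l p , cut-max l (boundedˡ l (join-perm⁻ l p)) ch

  Whole-injective : ∀ {x y} → Whole x → Whole y → join N x ≡ join N y → x ≡ y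
  Whole-injective {l , _} {l′ , _} (p , _) (p′ , _) =
    join-injective (max-∉ (boundedˡ l p)) (max-∉ (boundedˡ l′ p′))

++≡join : ∀ N l r → l ++ N ∷ r ≡ join N (reverse l , r)
++≡join N l r = trans (cong (_++ N ∷ r) (sym (reverse-involutive l))) (sym (ʳ++-defn (reverse l)))

Alt-card : ∀ e m → Card (Alt e (suc m)) (# m lo hi (suc m) lo e (suc m))
Alt-card e m = Card-cong to from (Card-Image (join (suc m)) Whole-injective (#-card m lo hi (suc m) lo e (suc m)))
  where
  to : ∀ σ → Image (join (suc m)) (Whole {e} {m}) σ → Alt e (suc m) σ
  to _ (_ , z , refl) = Whole⇒Alt z
  from : ∀ σ → Alt e (suc m) σ → Image (join (suc m)) (Whole {e} {m}) σ
  from σ a@(p , _) with ∈-∃++ (∈-resp-↭ (↭-sym (↭-trans p (letters-∷ʳ m))) (here refl))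
  ... | l , r , eq = (reverse l , r) , Alt⇒Whole (subst (Alt e (suc m)) eq′ a) , eq′
    where eq′ = trans eq (++≡join (suc m) l r)

-- Counts at the extreme thresholds.

module Ends (e : Side) where

  -- The left word ends at the first letter of the permutation, a peak.
  open Counts hi e public

  -- By `Alt-card`, the number of alternating permutations of `suc m` letters with end type `e`; it
  -- becomes the row sum in the initial values.
  total : ℕ → ℕ
  total m = LL m (suc m)

  -- No letter reaches the threshold, so the left word is empty; but an empty word on side `hi` has
  -- end type `lo`.
  HH-top : ∀ m → HH m (suc m) ≡ 0
  HH-top m = #-∅ empty
    where
    empty : ∀ x → ¬ Zip m hi hi (suc m) hi e (suc m) x
    empty ([] , b) (_ , () , _)
    empty (a@(_ ∷ _) , b) (p , ca , _) with high-is-empty (boundedˡ a p) ca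
    ... | ()

  HH-bottom : ∀ m → HH m 1 + LL m 1 ≡ total m
  HH-bottom m = trans (sym (HH+LL-constant m m ≤-refl)) (cong (_+ total m) (HH-top m))

  LL-bottom : ∀ m → LL (suc m) 1 ≡ 0
  LL-bottom m = #-∅ empty
    where
    empty : ∀ x → ¬ Zip (suc m) lo hi 1 lo e 1 x
    empty (a , b) (p , ca , cb) with low-is-empty (positiveˡ a p) ca | low-is-empty (positiveʳ a p) cb
    ... | refl | refl with IsPerm-length {suc m} p
    ... | ()

  -- The low left word is empty, and the right word is then an arbitrary alternating permutation of
  -- all the letters.
  LH-bottom : ∀ m → LH (suc m) 1 ≡ total m
  LH-bottom m = Card-unique (#-card (suc m) lo hi 1 hi e 1)
    (Card-cong to from (Card-Image right right-injective (Alt-card e m)))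
    where
    right : List ℕ → List ℕ × List ℕ
    right σ = [] , σ
    right-injective : ∀ {x y} → Alt e (suc m) x → Alt e (suc m) y → right x ≡ right y → x ≡ y
    right-injective _ _ refl = refl
    to : ∀ x → Image right (Alt e (suc m)) x → Zip (suc m) lo hi 1 hi e 1 x
    to _ (σ , (p , ch) , refl) = p , refl , ch
    from : ∀ x → Zip (suc m) lo hi 1 hi e 1 x → Image right (Alt e (suc m)) x
    from (a , b) (p , ca , cb) with low-is-empty (positiveˡ a p) ca
    ... | refl = b , (p , cb) , refl

-- With both end types `hi` the two words are interchangeable. Here the odd and even initial values
-- part ways.
HL-bottom-odd : ∀ m → Ends.HL hi (suc m) 1 ≡ Ends.total hi m
HL-bottom-odd m = trans (#-swap (suc m) hi hi 1 lo hi 1) (Ends.LH-bottom hi m)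

-- The low right word would be empty, with end type `hi` instead of `lo`.
HL-bottom-even : ∀ m → Ends.HL lo m 1 ≡ 0
HL-bottom-even m = #-∅ empty
  where
  empty : ∀ x → ¬ Zip m hi hi 1 lo lo 1 x
  empty (a , b) (p , _ , cb) with low-is-empty (positiveʳ a p) cb
  empty (a , []) (_ , _ , ()) | refl

-- Distribution of the greater neighbour.

head0-low : ∀ {e k} w → Chain lo e (suc k) w → head0 w ≤ k
head0-low []      _           = z≤n
head0-low (x ∷ w) (s≤s x≤k , _) = x≤k

relow : ∀ {e i j} w → Chain lo e i w → head0 w < j → Chain lo e j w
relow []      ch       _  = ch
relow (x ∷ w) (_ , ch) lt = lt , ch

module _ (e : Side) (m : ℕ) where

  greater : List ℕ × List ℕ → ℕ
  greater (l , r) = head0 l ⊔ head0 r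

  GZip : ℕ → List ℕ × List ℕ → Set
  GZip k x = Zip m lo hi (suc k) lo e (suc k) x × k ≡ greater x

  abstract
    greaterCountable : ∀ k → ∃[ c ] Card (GZip k) c
    greaterCountable k = Card-finite _≟ᵖ_ (λ x → zip? m lo hi (suc k) lo e (suc k) x ×-dec (k ≟ greater x))
      (splits m) λ _ → ∈-splits ∘ proj₁ ∘ proj₁

  #grn : ℕ → ℕ
  #grn k = proj₁ (greaterCountable k)

  open Ends e

  greater≤ : ∀ {k} x → Zip m lo hi (suc k) lo e (suc k) x → greater x ≤ k
  greater≤ (a , b) (_ , ca , cb) = ⊔-lub (head0-low a ca) (head0-low b cb)

  zip-relow : ∀ {i j} x → Zip m lo hi i lo e i x → greater x < j → Zip m lo hi j lo e j x
  zip-relow (a , b) (p , ca , cb) lt =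
    p , relow a ca (≤-<-trans (m≤m⊔n _ _) lt) , relow b cb (≤-<-trans (m≤n⊔m (head0 a) _) lt)

  #grn-zero : #grn 0 ≡ LL m 1
  #grn-zero = Card-unique (proj₂ (greaterCountable 0))
    (Card-cong (λ x z → z , sym (n≤0⇒n≡0 (greater≤ x z))) (λ _ → proj₁) (#-card m lo hi 1 lo e 1))

  -- Pairs with both heads at most `suc k` are split by whether the greater head attains `suc k`.
  #grn-suc : ∀ k → #grn (suc k) + LL m (suc k) ≡ LL m (2 + k)
  #grn-suc k = Card-unique
    (Card-cong to from (Card-⊎ disjoint (proj₂ (greaterCountable (suc k))) (#-card m lo hi (suc k) lo e (suc k))))
    (#-card m lo hi (2 + k) lo e (2 + k))
    where
    Below = Zip m lo hi (suc k) lo e (suc k)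
    disjoint : ∀ x → GZip (suc k) x → ¬ Below x
    disjoint x (_ , eq) z = <-irrefl (sym eq) (s≤s (greater≤ x z))
    to : ∀ x → GZip (suc k) x ⊎ Below x → Zip m lo hi (2 + k) lo e (2 + k) x
    to x (inj₁ (z , _)) = z
    to x (inj₂ z) = zip-relow x z (s≤s (m≤n⇒m≤1+n (greater≤ x z)))
    from : ∀ x → Zip m lo hi (2 + k) lo e (2 + k) x → GZip (suc k) x ⊎ Below x
    from x z with m≤n⇒m<n∨m≡n (greater≤ x z)
    ... | inj₁ lt = inj₂ (zip-relow x z lt)
    ... | inj₂ eq = inj₁ (z , sym eq)

#grn-pos : ∀ e {m k} → k ≤ m → #grn e (suc m) (suc k) ≡ Ends.S e m (suc k)
#grn-pos e {m} {k} k≤m = +-cancelʳ-≡ (LL (suc m) (suc k)) _ _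
  (trans (#grn-suc e (suc m) k) (trans (LL-step k≤m) (+-comm (LL (suc m) (suc k)) _)))
  where open Ends e

-- Translation to alternating permutations.

-- Sides alternate, so the length fixes the end type; length zero follows the convention of `Chain`.
end : Side → ℕ → Side
end s zero    = opp s
end s (suc l) = end (opp s) l

down⁺ : ∀ x w → Down (x ∷ w) → Chain lo (end lo (length w)) x w
up⁺   : ∀ x w → Up (x ∷ w) → Chain hi (end hi (length w)) (suc x) w
down⁺ x []      _          = refl
down⁺ x (y ∷ w) (y<x , up) = y<x , up⁺ y w up
up⁺   x []      _            = refl
up⁺   x (y ∷ w) (x<y , down) = x<y , down⁺ y w down

down⁻ : ∀ {e} x w → Chain lo e x w → Down (x ∷ w)
up⁻   : ∀ {e} x w → Chain hi e (suc x) w → Up (x ∷ w)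
down⁻ x []      _          = _
down⁻ x (y ∷ w) (y<x , ch) = y<x , up⁻ y w ch
up⁻   x []      _          = _
up⁻   x (y ∷ w) (x<y , ch) = x<y , down⁻ y w ch

alternating⁺ : ∀ {n σ} → IsPerm n σ → Alternating σ → Chain hi (end hi n) 1 σ
alternating⁺ {n} {σ} p d = subst (λ l → Chain hi (end hi l) 1 σ) (IsPerm-length p)
                             (chain σ (All.map proj₁ (perm-bounds p)) d)
  where
  chain : ∀ σ → All (1 ≤_) σ → Down σ → Chain hi (end hi (length σ)) 1 σ
  chain []      _         _ = refl
  chain (x ∷ w) (1≤x ∷ _) d = 1≤x , down⁺ x w d

alternating⁻ : ∀ {e} σ → Chain hi e 1 σ → Alternating σ
alternating⁻ []      _        = _
alternating⁻ (x ∷ w) (_ , ch) = down⁻ x w ch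

last0-∷ʳ : ∀ xs x → last0 (xs ++ x ∷ []) ≡ x
last0-∷ʳ []           x = refl
last0-∷ʳ (y ∷ [])     x = refl
last0-∷ʳ (y ∷ z ∷ xs) x = last0-∷ʳ (z ∷ xs) x

last0-reverse : ∀ l → last0 (reverse l) ≡ head0 l
last0-reverse []      = refl
last0-reverse (x ∷ l) = trans (cong last0 (unfold-reverse x l)) (last0-∷ʳ (reverse l) x)

-- The left word is stored backwards, so its head is the left neighbour of the maximum. Thresholds
-- rise from `suc k` to `suc m` because `k ≤ m`, and fall back because the greater head is `k`.
InA-card : ∀ {e m} → e ≡ end hi (suc m) → ∀ {k} → k ≤ m → Card (InA (suc m) k) (#grn e m k)
InA-card {e} {m} refl {k} k≤m = Card-cong to from (Card-Image (join N) injective (proj₂ (greaterCountable e m k)))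
  where
  N = suc m
  widen : ∀ x → Zip m lo hi (suc k) lo e (suc k) x → Whole {e} {m} x
  widen x z = zip-relow e m x z (≤-<-trans (greater≤ e m x z) (s≤s k≤m))
  injective : ∀ {x y} → GZip e m k x → GZip e m k y → join N x ≡ join N y → x ≡ y
  injective (z , _) (z′ , _) = Whole-injective (widen _ z) (widen _ z′)
  to : ∀ σ → Image (join N) (GZip e m k) σ → InA N k σ
  to _ ((l , r) , (z , eq) , refl) with Whole⇒Alt (widen (l , r) z)
  ... | p , ch = p , alternating⁻ _ ch
               , (reverse l , r , ʳ++-defn l , trans eq (cong (_⊔ head0 r) (sym (last0-reverse l))))
  from : ∀ σ → InA N k σ → Image (join N) (GZip e m k) σ
  from σ (p , alt , l , r , σ≡ , k≡) = (reverse l , r) , (zip-relow e m _ whole (s≤s (≤-reflexive (sym k≡′))) , k≡′) , σ≡′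
    where
    σ≡′ = trans σ≡ (++≡join N l r)
    whole = Alt⇒Whole (subst (Alt e N) σ≡′ (p , alternating⁺ p alt))
    k≡′ : k ≡ greater e m (reverse l , r)
    k≡′ = trans k≡ (cong (_⊔ head0 r) (trans (cong last0 (sym (reverse-involutive l))) (last0-reverse (reverse l))))

-- Recurrence, row sums and initial values.

#grn-recurrence : ∀ e {m k} → suc k ≤ m →
  #grn e (2 + m) (3 + k) + #grn e (2 + m) (suc k) + 4 * #grn e m (suc k) ≡ 2 * #grn e (2 + m) (2 + k)
#grn-recurrence e {suc n} {k} (s≤s k≤n)
  rewrite #grn-pos e (s≤s (s≤s k≤n)) | #grn-pos e (m≤n⇒m≤1+n (m≤n⇒m≤1+n k≤n)) | #grn-pos e k≤n | #grn-pos e (s≤s (m≤n⇒m≤1+n k≤n))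
  = Ends.S-second-difference e k≤n

sum : (ℕ → ℕ) → ℕ → ℕ
sum F zero    = 0
sum F (suc n) = sum F n + F n

sum-#grn : ∀ e m n → sum (#grn e m) (suc n) ≡ Ends.LL e m (suc n)
sum-#grn e m zero    = #grn-zero e m
sum-#grn e m (suc n) = trans (cong (_+ #grn e m (suc n)) (sum-#grn e m n)) (trans (+-comm _ (#grn e m (suc n))) (#grn-suc e m n))

sum-#grn-suc : ∀ e m n → sum (#grn e (suc m) ∘ suc) n ≡ Ends.LL e (suc m) (suc n)
sum-#grn-suc e m zero    = sym (Ends.LL-bottom e m)
sum-#grn-suc e m (suc n) = trans (cong (_+ #grn e (suc m) (suc n)) (sum-#grn-suc e m n))
                          (trans (+-comm _ (#grn e (suc m) (suc n))) (#grn-suc e (suc m) n))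

-- For the second value, `S-step` at the bottom threshold contributes `2 * HH m 1` minus
-- `2 * LL m 1`; adding `4 * LL m 1` completes this to twice the constant sum of `HH-bottom`.
#grn-first-two : ∀ e m → let open Ends e in
  #grn e (2 + m) 1 ≡ HL (suc m) 1 + total m × #grn e (2 + m) 2 + 4 * LL m 1 ≡ #grn e (2 + m) 1 + 2 * total m
#grn-first-two e m =
  trans (#grn-pos e z≤n) (cong (_+_ (HL (suc m) 1)) (LH-bottom m)) ,
  (begin
    #grn e (2 + m) 2 + 4 * LL m 1              ≡⟨ cong (_+ 4 * LL m 1) (#grn-pos e (s≤s z≤n)) ⟩
    S (suc m) 2 + 4 * LL m 1                ≡⟨ lhs (S (suc m) 2) (LL m 1) ⟩
    S (suc m) 2 + 2 * LL m 1 + 2 * LL m 1   ≡⟨ cong (_+ 2 * LL m 1) (S-step z≤n) ⟩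
    S (suc m) 1 + 2 * HH m 1 + 2 * LL m 1   ≡⟨ rhs (S (suc m) 1) (HH m 1) (LL m 1) ⟩
    S (suc m) 1 + 2 * (HH m 1 + LL m 1)     ≡⟨ cong₂ (λ x y → x + 2 * y) (sym (#grn-pos e z≤n)) (HH-bottom m) ⟩
    #grn e (2 + m) 1 + 2 * total m             ∎)
  where
  open Ends e
  open ≡-Reasoning
  lhs : ∀ x y → x + 4 * y ≡ x + 2 * y + 2 * y
  lhs = solve-∀
  rhs : ∀ x y z → x + 2 * y + 2 * z ≡ x + 2 * (y + z)
  rhs = solve-∀

-- Uniqueness of the solution of the recurrence.

-- The system for `f`, indexed from 0 and free of subtraction: `F p k` stands for
-- `f (suc p) (suc k)`, and `a`, `b` are the multiples of the previous row sum.
record IsCount (a b : ℕ) (F : ℕ → ℕ → ℕ) : Set where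
  field
    base   : F 0 0 ≡ 1
    first  : ∀ p → F (suc p) 0 ≡ a * sum (F p) (suc (2 * p))
    second : ∀ p → F (suc p) 1 ≡ b * sum (F p) (suc (2 * p))
    step   : ∀ p k → k ≤ 2 * p → F (suc p) (2 + k) + F (suc p) k + 4 * F p k ≡ 2 * F (suc p) (suc k)

2*suc : ∀ p → 2 * suc p ≡ 2 + 2 * p
2*suc = solve-∀

module _ {a b : ℕ} {F : ℕ → ℕ → ℕ} (count : IsCount a b F)
         (f : ℕ → ℕ → ℤ) (recur : Recurrence f) (f11 : f 1 1 ≡ + 1)
         (init : ∀ n → 2 ≤ n → f n 1 ≡ + a ℤ.* prevSum f n × f n 2 ≡ + b ℤ.* prevSum f n) where

  open IsCount count

  ΣZ-sum : ∀ {u : ℕ → ℤ} {U : ℕ → ℕ} n → (∀ k → k < n → u (suc k) ≡ + U k) → ΣZ n u ≡ + sum U n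
  ΣZ-sum zero    _  = refl
  ΣZ-sum (suc n) eq = cong₂ ℤ._+_ (ΣZ-sum n (λ k → eq k ∘ m<n⇒m<1+n)) (eq n ≤-refl)

  Agree : ℕ → Set
  Agree p = ∀ k → k ≤ 2 * p → f (suc p) (suc k) ≡ + F p k

  prevSum-sum : ∀ {p} → Agree p → prevSum f (2 + p) ≡ + sum (F p) (suc (2 * p))
  prevSum-sum {p} agree = trans (cong (λ n → ΣZ (n ∸ 1) (f (suc p))) (2*suc p))
    (ΣZ-sum (suc (2 * p)) λ { k (s≤s k≤) → agree k k≤ })

  scaled : ∀ {p} c → Agree p → + c ℤ.* prevSum f (2 + p) ≡ + (c * sum (F p) (suc (2 * p)))
  scaled c agree = trans (cong (ℤ._*_ (+ c)) (prevSum-sum agree)) (sym (ℤP.pos-* c _))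

  recurrence-unique : ∀ x y z w X Y Z W → x ℤ.- + 2 ℤ.* y ℤ.+ z ℤ.+ + 4 ℤ.* w ≡ + 0 →
    X + Z + 4 * W ≡ 2 * Y → y ≡ + Y → z ≡ + Z → w ≡ + W → x ≡ + X
  recurrence-unique x _ _ _ X Y Z W eq EQ refl refl refl = begin
    x                                           ≡⟨ isolate x (+ Y) (+ Z) (+ W) ⟩
    x ℤ.- + 2 ℤ.* + Y ℤ.+ + Z ℤ.+ + 4 ℤ.* + W ℤ.+ rest   ≡⟨ cong (ℤ._+ rest) eq ⟩
    + 0 ℤ.+ rest                                ≡⟨ ℤP.+-identityˡ rest ⟩
    + 2 ℤ.* + Y ℤ.- (+ Z ℤ.+ + 4 ℤ.* + W)       ≡⟨ cong (ℤ._- (+ Z ℤ.+ + 4 ℤ.* + W)) cast ⟩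
    + X ℤ.+ + Z ℤ.+ + 4 ℤ.* + W ℤ.- (+ Z ℤ.+ + 4 ℤ.* + W) ≡⟨ drop (+ X) (+ Z) (+ W) ⟩
    + X                                         ∎
    where
    open ≡-Reasoning
    rest = + 2 ℤ.* + Y ℤ.- (+ Z ℤ.+ + 4 ℤ.* + W)
    cast : + 2 ℤ.* + Y ≡ + X ℤ.+ + Z ℤ.+ + 4 ℤ.* + W
    cast = trans (sym (ℤP.pos-* 2 Y)) (trans (cong +_ (sym EQ)) (cong (ℤ._+_ (+ (X + Z))) (ℤP.pos-* 4 W)))
    isolate : ∀ x y z w → x ≡ x ℤ.- + 2 ℤ.* y ℤ.+ z ℤ.+ + 4 ℤ.* w ℤ.+ (+ 2 ℤ.* y ℤ.- (z ℤ.+ + 4 ℤ.* w))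
    isolate = ℤSolver.solve-∀
    drop : ∀ x z w → x ℤ.+ z ℤ.+ + 4 ℤ.* w ℤ.- (z ℤ.+ + 4 ℤ.* w) ≡ x
    drop = ℤSolver.solve-∀

  agree-step : ∀ {p} → Agree p → Agree (suc p)
  agree-step {p} agree zero _ =
    trans (proj₁ (init (2 + p) (s≤s (s≤s z≤n)))) (trans (scaled a agree) (cong +_ (sym (first p))))
  agree-step {p} agree (suc zero) _ =
    trans (proj₂ (init (2 + p) (s≤s (s≤s z≤n)))) (trans (scaled b agree) (cong +_ (sym (second p))))
  agree-step {p} agree (suc (suc k)) k+2≤ =
    recurrence-unique (f (2 + p) (3 + k)) (f (2 + p) (2 + k)) (f (2 + p) (suc k)) (f (suc p) (suc k))
      (F (suc p) (2 + k)) (F (suc p) (suc k)) (F (suc p) k) (F p k)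
      -- In row `2 + p` the recurrence reaches index `2 * p + 1`, so it yields every entry after the
      -- second.
      (recur (2 + p) (suc k) (s≤s (s≤s z≤n)) (s≤s z≤n) (subst (suc k ≤_) (sym range) (s≤s k≤)))
      (step p k k≤)
      (agree-step agree (suc k) (≤-trans (n≤1+n _) k+2≤))
      (agree-step agree k (≤-trans (m≤n+m k 2) k+2≤))
      (agree k k≤)
    where
    k≤ : k ≤ 2 * p
    k≤ = s≤s⁻¹ (s≤s⁻¹ (subst (2 + k ≤_) (2*suc p) k+2≤))
    range : 2 * (2 + p) ∸ 3 ≡ suc (2 * p)
    range = cong (_∸ 3) (trans (2*suc (suc p)) (cong (_+_ 2) (2*suc p)))

  agreement : ∀ p → Agree p
  agreement zero    zero _ = trans f11 (cong +_ (sym base))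
  agreement (suc p) = agree-step (agreement p)

-- The odd and even families.

oddCount : IsCount 0 2 (λ p → #grn hi (2 * p))
oddCount = record
  { base = trans (#grn-zero hi 0) (#-zero refl refl)
  ; first = λ p → trans (cong (λ m → #grn hi m 0) (2*suc p)) (trans (#grn-zero hi (2 + 2 * p)) (Ends.LL-bottom hi (suc (2 * p))))
  ; second = λ p → trans (cong (λ m → #grn hi m 1) (2*suc p)) (trans (first-value (2 * p)) (cong (2 *_) (sym (sum-#grn hi (2 * p) (2 * p)))))
  ; step = λ p → subst (λ m → ∀ k → k ≤ 2 * p → #grn hi m (2 + k) + #grn hi m k + 4 * #grn hi (2 * p) k ≡ 2 * #grn hi m (suc k))
             (sym (2*suc p)) (step (2 * p))
  }
  where
  open Ends hi
  first-value : ∀ m → #grn hi (2 + m) 1 ≡ 2 * total m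
  first-value m = trans (proj₁ (#grn-first-two hi m)) (trans (cong (_+ total m) (HL-bottom-odd m)) (double (total m)))
    where
    double : ∀ x → x + x ≡ 2 * x
    double = solve-∀
  step : ∀ m k → k ≤ m → #grn hi (2 + m) (2 + k) + #grn hi (2 + m) k + 4 * #grn hi m k ≡ 2 * #grn hi (2 + m) (suc k)
  step m (suc k) k<m = #grn-recurrence hi k<m
  -- `#grn-recurrence` concerns positive indices. At index 0 the term `4 * LL m 1`, nonzero for
  -- `m = 0`, is the one in `#grn-first-two`.
  step m zero _ = begin
    #grn hi (2 + m) 2 + #grn hi (2 + m) 0 + 4 * #grn hi m 0
      ≡⟨ cong₂ (λ x y → #grn hi (2 + m) 2 + x + 4 * y) (trans (#grn-zero hi (2 + m)) (LL-bottom (suc m))) (#grn-zero hi m) ⟩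
    #grn hi (2 + m) 2 + 0 + 4 * LL m 1  ≡⟨ cong (_+ 4 * LL m 1) (+-identityʳ (#grn hi (2 + m) 2)) ⟩
    #grn hi (2 + m) 2 + 4 * LL m 1      ≡⟨ proj₂ (#grn-first-two hi m) ⟩
    #grn hi (2 + m) 1 + 2 * total m     ≡⟨ cong (_+_ (#grn hi (2 + m) 1)) (sym (first-value m)) ⟩
    #grn hi (2 + m) 1 + #grn hi (2 + m) 1  ≡⟨ cong (_+_ (#grn hi (2 + m) 1)) (sym (+-identityʳ _)) ⟩
    2 * #grn hi (2 + m) 1               ∎
    where open ≡-Reasoning

-- With at least two letters the greater neighbour is positive, so rows start at 1.
evenCount : IsCount 1 3 (λ p k → #grn lo (suc (2 * p)) (suc k))
evenCount = record
  { base = trans (#grn-pos lo z≤n) (cong₂ _+_ (HL-bottom-even 0) (#-zero refl refl))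
  ; first = λ p → trans (cong (λ m → #grn lo (suc m) 1) (2*suc p)) (trans (first-value _) (trans (total-sum p) (sym (*-identityˡ _))))
  ; second = λ p → trans (cong (λ m → #grn lo (suc m) 2) (2*suc p)) (trans (second-value (2 * p)) (cong (3 *_) (total-sum p)))
  ; step = λ p k k≤ → subst (λ m → #grn lo (suc m) (3 + k) + #grn lo (suc m) (suc k) + 4 * #grn lo (suc (2 * p)) (suc k) ≡ 2 * #grn lo (suc m) (2 + k))
             (sym (2*suc p)) (#grn-recurrence lo (s≤s k≤))
  }
  where
  open Ends lo
  total-sum : ∀ p → total (suc (2 * p)) ≡ sum (λ k → #grn lo (suc (2 * p)) (suc k)) (suc (2 * p))
  total-sum p = sym (sum-#grn-suc lo (2 * p) (suc (2 * p)))
  first-value : ∀ m → #grn lo (2 + m) 1 ≡ total m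
  first-value m = trans (proj₁ (#grn-first-two lo m)) (cong (_+ total m) (HL-bottom-even (suc m)))
  second-value : ∀ m → #grn lo (3 + m) 2 ≡ 3 * total (suc m)
  second-value m = begin
    #grn lo (3 + m) 2                         ≡⟨ sym (+-identityʳ _) ⟩
    #grn lo (3 + m) 2 + 4 * 0                 ≡⟨ cong (λ x → #grn lo (3 + m) 2 + 4 * x) (sym (LL-bottom m)) ⟩
    #grn lo (3 + m) 2 + 4 * LL (suc m) 1      ≡⟨ proj₂ (#grn-first-two lo (suc m)) ⟩
    #grn lo (3 + m) 1 + 2 * total (suc m)     ≡⟨ cong (_+ 2 * total (suc m)) (first-value (suc m)) ⟩
    3 * total (suc m)                      ∎
    where open ≡-Reasoning

-- Parity of the length, and the two formulas.

end-odd : ∀ p → end hi (suc (2 * p)) ≡ hi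
end-odd zero = refl
end-odd (suc p) = trans (cong (end hi ∘ suc) (2*suc p)) (end-odd p)

end-even : ∀ p → end hi (2 + 2 * p) ≡ lo
end-even zero = refl
end-even (suc p) = trans (cong (end hi ∘ suc ∘ suc) (2*suc p)) (end-even p)

theorem1p4 : (g h : ℕ → ℕ → ℤ) → IsSolG g → IsSolH h →
    ∀ n k → 1 ≤ n → 1 ≤ k → k ≤ 2 * n ∸ 1 →
    (∃[ c ] (HasCard (InA (2 * n ∸ 1) (k ∸ 1)) c × g n k ≡ + c))
    × (∃[ c ] (HasCard (InA (2 * n) k) c × h n k ≡ + c))
theorem1p4 g h (recG , g11 , initG) (recH , h11 , initH) (suc p) (suc k) _ _ k<
  = ( #grn hi (2 * p) k
    , subst (λ N → HasCard (InA (N ∸ 1) k) (#grn hi (2 * p) k)) (sym (2*suc p)) (InA-card (sym (end-odd p)) k≤)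
    , agreement oddCount g recG g11 (λ n 2≤n → initG n 2≤n) p k k≤ )
  , ( #grn lo (suc (2 * p)) (suc k)
    , subst (λ N → HasCard (InA N (suc k)) (#grn lo (suc (2 * p)) (suc k))) (sym (2*suc p)) (InA-card (sym (end-even p)) (s≤s k≤))
    , agreement evenCount h recH h11
        (λ n 2≤n → trans (proj₁ (initH n 2≤n)) (sym (ℤP.*-identityˡ _)) , proj₂ (initH n 2≤n)) p k k≤ )
  where
  k≤ : k ≤ 2 * p
  k≤ = s≤s⁻¹ (subst (λ m → suc k ≤ m ∸ 1) (2*suc p) k<)
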